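{- For $i=1,2$ let $\mathcal L_i=\langle C_i,\models_{M_i}\rangle$ be matrix logics, where $M_i=(\mathbf A_i,D_i)$ is a $C_i$-matrix with universe $A_i$, and let $(\lambda,\mu)$ be an admissible pair. Then $[\mathcal L_1\odot\mathcal L_2]_{(\lambda,\mu)}$ is a strong conservative extension of both logics: for each $i\in\{1,2\}$ and every $\Gamma\cup\{\varphi\}\subseteq L(C_i)$, $\Gamma\models_{M_i}\varphi$ if and only if $\Gamma\models_{(M_1\circledast M_2)_{(\lambda,\mu)}}\varphi$.
   Context: Fix a countable set $\mathcal V=\{p_1,p_2,\dots\}$ of propositional variables. A signature $C=\{C^k\}_{k\in\mathbb N}$ is a family of pairwise disjoint sets, disjoint from $\mathcal V$ ($C^k$ is the set of $k$-ary connectives); $L(C)$ is the absolutely free algebra over $C$ generated by $\mathcal V$. A $C$-matrix is $M=(\mathbf A,D)$ with $\mathbf A$ a $C$-algebra with universe $A$ and $D\subseteq A$. An $M$-valuation is a homomorphism $v:L(C)\to\mathbf A$. $\Gamma\models_M\varphi$ means: for every $M$-valuation $v$, $v(\Gamma)\subseteq D$ implies $v(\varphi)\in D$. A matrix logic here is a pair $\langle C,\models_M\rangle$. A fibring pair is $(\lambda,\mu)$ with $\lambda:A_1\to A_2$, $\mu:A_2\to A_1$. It is admissible if for every $x\in A_1$: $\lambda(x)\in D_2$ iff $x\in D_1$; and for every $y\in A_2$: $\mu(y)\in D_1$ iff $y\in D_2$. Put $C_\circledast=C_1\uplus C_2$, $A_\circledast=A_1\uplus A_2$, $D_\circledast=D_1\uplus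 D_2$ (disjoint unions; $L(C_i)$ is regarded as a subset of $L(C_\circledast)$). Define $\ast_\lambda:A_\circledast\to A_2$ by $\ast_\lambda(x)=\lambda(x)$ if $x\in A_1$, $\ast_\lambda(x)=x$ if $x\in A_2$; and $\ast_\mu:A_\circledast\to A_1$ by $\ast_\mu(x)=x$ if $x\in A_1$, $\ast_\mu(x)=\mu(x)$ if $x\in A_2$. The fibred $C_\circledast$-matrix $(M_1\circledast M_2)_{(\lambda,\mu)}$ has universe $A_\circledast$, designated set $D_\circledast$, and operations $c(x_1,\dots,x_k)=c^{\mathbf A_1}(\ast_\mu(x_1),\dots,\ast_\mu(x_k))$ for $c\in C_1^k$ and $c(x_1,\dots,x_k)=c^{\mathbf A_2}(\ast_\lambda(x_1),\dots,\ast_\lambda(x_k))$ for $c\in C_2^k$. For admissible $(\lambda,\mu)$, the logic $\langle C_\circledast,\models_{(M_1\circledast M_2)_{(\lambda,\mu)}}\rangle$ is denoted $[\mathcal L_1\odot\mathcal L_2]_{(\lambda,\mu)}$. -}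

module Defs where

open import Level using (Level; _⊔_; suc)
open import Data.Nat.Base using (ℕ)
open import Data.Product.Base using (_×_; ∃-syntax)
open import Data.Sum.Base using (_⊎_; inj₁; inj₂; [_,_]′)
open import Data.Sum.Relation.Unary.All using (All)
open import Data.Vec.Base using (Vec; []; _∷_; map)
open import Function.Base using (id)
open import Function.Bundles using (_⇔_)
open import Relation.Binary.PropositionalEquality.Core using (_≡_)
open import Relation.Unary using (Pred; _∈_)

private
  variable
    a a₁ a₂ c c₁ c₂ d d₁ d₂ ℓ : Level

-- Indexing by arity makes the sets of connectives pairwise disjoint.
Signature : (c : Level) → Set (suc c)
Signature c = ℕ → Set c

-- The absolutely free algebra; `var n` is the n-th propositional variable.
data L (C : Signature c) : Set c where
  var : ℕ → L C
  con : ∀ {k} → C k → Vec (L C) k → L C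

record Matrix (C : Signature c) (a d : Level) : Set (c ⊔ suc (a ⊔ d)) where
  field
    Carrier    : Set a
    ⟦_⟧        : ∀ {k} → C k → Vec Carrier k → Carrier
    Designated : Pred Carrier d

record Valuation {C : Signature c} (M : Matrix C a d) : Set (c ⊔ a) where
  open Matrix M
  field
    val : L C → Carrier
    hom : ∀ {k} (f : C k) (φs : Vec (L C) k) →
          val (con f φs) ≡ ⟦ f ⟧ (map val φs)

infix 4 _⊨[_]_

_⊨[_]_ : {C : Signature c} → Pred (L C) ℓ → Matrix C a d → L C → Set (c ⊔ a ⊔ d ⊔ ℓ)
Γ ⊨[ M ] φ = (v : Valuation M) → let open Valuation v; open Matrix M in
             (∀ {ψ} → ψ ∈ Γ → val ψ ∈ Designated) → val φ ∈ Designated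

infixr 6 _⊎ˢ_

_⊎ˢ_ : Signature c₁ → Signature c₂ → Signature (c₁ ⊔ c₂)
(C₁ ⊎ˢ C₂) k = C₁ k ⊎ C₂ k

module _ {C : Signature c₁} {C′ : Signature c₂} (h : ∀ {k} → C k → C′ k) where

  -- `rename*` is `map rename`, spelled out so that the recursion is structural.
  mutual
    rename : L C → L C′
    rename (var n)    = var n
    rename (con f φs) = con (h f) (rename* φs)

    rename* : ∀ {k} → Vec (L C) k → Vec (L C′) k
    rename* []       = []
    rename* (φ ∷ φs) = rename φ ∷ rename* φs

-- The inclusions of L C₁ and L C₂ in L (C₁ ⊎ˢ C₂); variables are shared.
module _ {C₁ : Signature c₁} {C₂ : Signature c₂} where

  ι₁ : L C₁ → L (C₁ ⊎ˢ C₂)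
  ι₁ = rename inj₁

  ι₂ : L C₂ → L (C₁ ⊎ˢ C₂)
  ι₂ = rename inj₂

image : {A : Set a₁} {B : Set a₂} → (A → B) → Pred A ℓ → Pred B (a₁ ⊔ a₂ ⊔ ℓ)
image f P y = ∃[ x ] (x ∈ P × f x ≡ y)

module _ {C₁ : Signature c₁} {C₂ : Signature c₂}
         (M₁ : Matrix C₁ a₁ d₁) (M₂ : Matrix C₂ a₂ d₂) where

  private
    module M₁ = Matrix M₁
    module M₂ = Matrix M₂

  -- `to₂` and `to₁` are the maps written λ and μ.
  record FibringPair : Set (a₁ ⊔ a₂) where
    field
      to₂ : M₁.Carrier → M₂.Carrier
      to₁ : M₂.Carrier → M₁.Carrier

  record Admissible (p : FibringPair) : Set (a₁ ⊔ a₂ ⊔ d₁ ⊔ d₂) where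
    open FibringPair p
    field
      to₂-designated : ∀ x → (to₂ x ∈ M₂.Designated) ⇔ (x ∈ M₁.Designated)
      to₁-designated : ∀ y → (to₁ y ∈ M₁.Designated) ⇔ (y ∈ M₂.Designated)

  module _ (p : FibringPair) where
    open FibringPair p

    -- `collapse₂` and `collapse₁` are the maps written ∗_λ and ∗_μ.
    collapse₂ : M₁.Carrier ⊎ M₂.Carrier → M₂.Carrier
    collapse₂ = [ to₂ , id ]′

    collapse₁ : M₁.Carrier ⊎ M₂.Carrier → M₁.Carrier
    collapse₁ = [ id , to₁ ]′

    fibred : Matrix (C₁ ⊎ˢ C₂) (a₁ ⊔ a₂) (a₁ ⊔ a₂ ⊔ d₁ ⊔ d₂)
    fibred = record
      { Carrier    = M₁.Carrier ⊎ M₂.Carrier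
      ; ⟦_⟧        = λ { (inj₁ f) xs → inj₁ (M₁.⟦ f ⟧ (map collapse₁ xs))
                       ; (inj₂ f) xs → inj₂ (M₂.⟦ f ⟧ (map collapse₂ xs)) }
      ; Designated = All M₁.Designated M₂.Designated
      }

{-# OPTIONS --safe #-}
-- The map ∗_μ (respectively ∗_λ) is a strict surjective homomorphism from the
-- reduct of the fibred matrix to M₁ (respectively M₂): it commutes with the
-- operations by definition of the fibring, the injection into the disjoint union
-- is a section, and admissibility says that it preserves and reflects designated
-- values.  Such a map preserves and reflects consequence: valuations are composed
-- with it in one direction and lifted through the section, on the variables, in
-- the other.
module Submission where

open import Defs
open import Level using (Level)
open import Data.Nat.Base using (ℕ)
open import Data.Product using (_×_; _,_)
open import Data.Sum.Base using (inj₁; inj₂)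
open import Data.Sum.Relation.Unary.All using (inj₁; inj₂)
open import Data.Vec.Base using (Vec; []; _∷_; map)
open import Data.Vec.Properties using (map-∘)
open import Function.Base using (_∘_)
open import Function.Bundles using (_⇔_; mk⇔; module Equivalence)
open import Relation.Binary.PropositionalEquality
  using (_≡_; refl; sym; trans; cong; cong₂; subst; module ≡-Reasoning)
open import Relation.Unary using (Pred; _∈_)

open Valuation

private
  variable
    c c′ a a′ d d′ ℓ : Level

module _ {C : Signature c} (M : Matrix C a d) where
  open Matrix M

  module _ (ρ : ℕ → Carrier) where

    mutual
      -- The extension of `ρ` that freeness of `L C` provides; `eval*` stands for `map eval` in a
      -- structurally recursive form.
      eval : L C → Carrier
      eval (var n)    = ρ n
      eval (con f φs) = ⟦ f ⟧ (eval* φs)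

      eval* : ∀ {k} → Vec (L C) k → Vec Carrier k
      eval* []       = []
      eval* (φ ∷ φs) = eval φ ∷ eval* φs

    eval*≡map : ∀ {k} (φs : Vec (L C) k) → eval* φs ≡ map eval φs
    eval*≡map []       = refl
    eval*≡map (φ ∷ φs) = cong (eval φ ∷_) (eval*≡map φs)

    valuation : Valuation M
    valuation = record { val = eval ; hom = λ f φs → cong ⟦ f ⟧ (eval*≡map φs) }

  module _ (v w : Valuation M) (v≡w : ∀ n → val v (var n) ≡ val w (var n)) where

    mutual
      -- Both `hom` fields reduce a comparison at `con f φs` to the arguments. This identifies a
      -- lifted and pulled-back valuation with the original one from its variables.
      val-unique : ∀ φ → val v φ ≡ val w φ
      val-unique (var n)    = v≡w n
      val-unique (con f φs) =
        trans (hom v f φs) (trans (cong ⟦ f ⟧ (val-unique* φs)) (sym (hom w f φs)))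

      val-unique* : ∀ {k} (φs : Vec (L C) k) → map (val v) φs ≡ map (val w) φs
      val-unique* []       = refl
      val-unique* (φ ∷ φs) = cong₂ _∷_ (val-unique φ) (val-unique* φs)

module _ {C : Signature c} {C′ : Signature c′} (h : ∀ {k} → C k → C′ k) where

  rename*≡map : ∀ {k} (φs : Vec (L C) k) → rename* h φs ≡ map (rename h) φs
  rename*≡map []       = refl
  rename*≡map (φ ∷ φs) = cong (rename h φ ∷_) (rename*≡map φs)

  module _ (M : Matrix C a d) (N : Matrix C′ a′ d′) where

    private
      module M = Matrix M
      module N = Matrix N

    module _ (π : N.Carrier → M.Carrier)
             (π-hom : ∀ {k} (f : C k) xs → π (N.⟦ h f ⟧ xs) ≡ M.⟦ f ⟧ (map π xs)) where

      pullback : Valuation N → Valuation M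
      pullback w = record { val = u ; hom = u-hom }
        where
        u : L C → M.Carrier
        u = π ∘ val w ∘ rename h

        u-hom : ∀ {k} (f : C k) φs → u (con f φs) ≡ M.⟦ f ⟧ (map u φs)
        u-hom f φs = begin
          π (val w (con (h f) (rename* h φs)))
            ≡⟨ cong π (hom w (h f) (rename* h φs)) ⟩
          π (N.⟦ h f ⟧ (map (val w) (rename* h φs)))
            ≡⟨ π-hom f _ ⟩
          M.⟦ f ⟧ (map π (map (val w) (rename* h φs)))
            ≡⟨ cong (M.⟦ f ⟧ ∘ map π ∘ map (val w)) (rename*≡map φs) ⟩
          M.⟦ f ⟧ (map π (map (val w) (map (rename h) φs)))
            ≡⟨ cong (M.⟦ f ⟧ ∘ map π) (map-∘ (val w) (rename h) φs) ⟨
          M.⟦ f ⟧ (map π (map (val w ∘ rename h) φs))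
            ≡⟨ cong M.⟦ f ⟧ (map-∘ π (val w ∘ rename h) φs) ⟨
          M.⟦ f ⟧ (map u φs) ∎
          where open ≡-Reasoning

      module _ (π-strict : ∀ x → (π x ∈ M.Designated) ⇔ (x ∈ N.Designated))
               (σ : M.Carrier → N.Carrier) (π∘σ : ∀ x → π (σ x) ≡ x) where

        private
          module Strict x = Equivalence (π-strict x)

        ⊨-strict-retraction : (Γ : Pred (L C) ℓ) (φ : L C) →
          (Γ ⊨[ M ] φ) ⇔ (image (rename h) Γ ⊨[ N ] rename h φ)
        ⊨-strict-retraction Γ φ = mk⇔ ⇒ ⇐
          where
          ⇒ : Γ ⊨[ M ] φ → image (rename h) Γ ⊨[ N ] rename h φ
          -- `pullback w` sends `ψ` to `π (val w (rename h ψ))`, so strictness trades designation in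
          -- `M` for designation of the renamed formula in `N`.
          ⇒ Γ⊨φ w wΓ = Strict.to _
            (Γ⊨φ (pullback w) λ ψ∈Γ → Strict.from _ (wΓ (_ , ψ∈Γ , refl)))

          ⇐ : image (rename h) Γ ⊨[ N ] rename h φ → Γ ⊨[ M ] φ
          ⇐ hΓ⊨hφ v vΓ = subst M.Designated (π∘w≡v φ)
            (Strict.from _ (hΓ⊨hφ w λ { (ψ , ψ∈Γ , refl) →
              Strict.to _ (subst M.Designated (sym (π∘w≡v ψ)) (vΓ ψ∈Γ)) }))
            where
            w : Valuation N
            -- Only values of variables pass through `σ`, a mere function; compound formulas are
            -- evaluated by the operations of `N`.
            w = valuation N (σ ∘ val v ∘ var)

            π∘w≡v : ∀ ψ → π (val w (rename h ψ)) ≡ val v ψ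
            π∘w≡v = val-unique M (pullback w) v (π∘σ ∘ val v ∘ var)

proposition3p9 : ∀ {c₁ c₂ a₁ a₂ d₁ d₂ ℓ : Level}
    {C₁ : Signature c₁} {C₂ : Signature c₂}
    (M₁ : Matrix C₁ a₁ d₁) (M₂ : Matrix C₂ a₂ d₂)
    (p : FibringPair M₁ M₂) → Admissible M₁ M₂ p →
    (∀ (Γ : Pred (L C₁) ℓ) (φ : L C₁) →
    (Γ ⊨[ M₁ ] φ) ⇔ (image (ι₁ {C₁ = C₁} {C₂ = C₂}) Γ ⊨[ fibred M₁ M₂ p ] ι₁ φ))
    × (∀ (Γ : Pred (L C₂) ℓ) (φ : L C₂) →
    (Γ ⊨[ M₂ ] φ) ⇔ (image (ι₂ {C₁ = C₁} {C₂ = C₂}) Γ ⊨[ fibred M₁ M₂ p ] ι₂ φ))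
proposition3p9 M₁ M₂ p adm =
    -- A connective of `C₁` collapses its arguments and lands in the first summand, where
    -- `collapse₁` is the identity: the homomorphism law holds by computation.
    ⊨-strict-retraction inj₁ M₁ M⊛ (collapse₁ M₁ M₂ p) (λ _ _ → refl) strict₁ inj₁ (λ _ → refl)
  , ⊨-strict-retraction inj₂ M₂ M⊛ (collapse₂ M₁ M₂ p) (λ _ _ → refl) strict₂ inj₂ (λ _ → refl)
  where
  open Admissible adm

  M⊛ = fibred M₁ M₂ p

  strict₁ : ∀ x → (collapse₁ M₁ M₂ p x ∈ Matrix.Designated M₁) ⇔ (x ∈ Matrix.Designated M⊛)
  strict₁ (inj₁ x) = mk⇔ inj₁ λ { (inj₁ Dx) → Dx }
  -- On the foreign summand `collapse₁` is `to₁`, so strictness is the admissibility condition at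
  -- `y`.
  strict₁ (inj₂ y) = mk⇔ (inj₂ ∘ to) λ { (inj₂ Dy) → from Dy }
    where open Equivalence (to₁-designated y)

  strict₂ : ∀ x → (collapse₂ M₁ M₂ p x ∈ Matrix.Designated M₂) ⇔ (x ∈ Matrix.Designated M⊛)
  strict₂ (inj₁ x) = mk⇔ (inj₁ ∘ to) λ { (inj₁ Dx) → from Dx }
    where open Equivalence (to₂-designated x)
  strict₂ (inj₂ y) = mk⇔ inj₂ λ { (inj₂ Dy) → Dy }
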